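{- The single facility upgrading maximal covering location problem, 1-Up-MCLP, restricted to instances whose network is a star and whose node weights are uniform (there is $w\in\mathbb{R}^+$ with $w_i=w$ for all $i\in V$), can be solved in $O(n\log n)$ time, where $n$ is the number of nodes. That is, there is an algorithm which, given any such instance, computes an optimal solution $(X_1,\delta)$ in $O(n\log n)$ time.
   Context: Problem $p$-Up-MCLP. An instance consists of: an undirected network $N=(V,E,\ell)$ with finite node set $V$, $|V|=n$, edge set $E$ and positive edge lengths $\ell_e$, $e\in E$; non-negative node weights $w_i$, $i\in V$; a coverage radius $R>0$; upgrading bounds $u_e\in[0,\ell_e)$, $e\in E$; upgrading costs per unit $c_e\in\mathbb{R}^+$, $e\in E$; a budget $B\in\mathbb{R}^+$; and a number $p\in\mathbb{N}$ of facilities, $p\le|V|$. For a vector of reductions $\delta=(\delta_e)_{e\in E}$ with $0\le\delta_e\le u_e$, $d(i,j,\delta)$ is the length of a shortest path between $i$ and $j$ in the network where each edge $e$ has length $\ell_e-\delta_e$. For $X\subseteq V$ let $C(X,\delta)=\{i\in V \mid \exists j\in X:\ d(i,j,\delta)\le R\}$ be the set of covered nodes. A feasible solution is a pair $(X_p,\delta)$ with $X_p\subseteq V$, $|X_p|=p$, $0\le\delta_e\le u_e$ for all $e\in E$, and $\sum_{e\in E}c_e\delta_e\le B$; the objective is to maximise $\sum_{i\in C(X_p,\delta)}w_i$. The 1-Up-MCLP is the case $p=1$. A star network is a network with a central node $v_0$ whose edges are exactly those joining $v_0$ to each of the other (satellite) nodes. Costs $c_e$, bounds $u_e$ and lengths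 $\ell_e$ may be arbitrary (non-uniform). Running time counts elementary arithmetic operations and comparisons on the input numbers, each at unit cost. -}

module Defs where

open import Algebra.Bundles using (CommutativeRing)
import Algebra.Properties.CommutativeMonoid.Sum as Sum
open import Data.Bool.Base using (if_then_else_)
open import Data.Fin.Base using (Fin)
open import Data.Fin.Subset using (Subset; _∈_; ∣_∣)
open import Data.List.Base using (List; []; _∷_)
open import Data.List.Relation.Unary.Unique.Propositional using (Unique)
open import Data.Nat.Base as ℕ using (ℕ; suc)
open import Data.Product.Base using (Σ; ∃-syntax; _×_; _,_; map₂; proj₁; proj₂)
open import Data.Sum.Base using (_⊎_)
open import Data.Vec.Base using (lookup)
open import Function.Bundles using (_⇔_)
open import Level using (Level; _⊔_) renaming (suc to lsuc)
open import Relation.Binary.Core using (Rel)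
import Relation.Binary.Construct.NonStrictToStrict as ToStrict
open import Relation.Binary.PropositionalEquality.Core using (_≡_; _≢_)
open import Relation.Binary.Structures using (IsDecTotalOrder)
open import Relation.Nullary.Decidable.Core using (does)
open import Relation.Nullary.Negation.Core using (¬_)

-- The numbers of an instance live in an arbitrary ordered field.  The standard
-- library has no real numbers; classically ℝ is one of these fields, and the
-- decidable order is the unit-cost comparison of the computation model.
-- The inverse is total, but nothing is known about 0# ⁻¹.

record OrderedField (c ℓ₁ ℓ₂ : Level) : Set (lsuc (c ⊔ ℓ₁ ⊔ ℓ₂)) where
  infix  4 _≤_
  infix  8 _⁻¹
  field
    commutativeRing : CommutativeRing c ℓ₁

  open CommutativeRing commutativeRing public

  field
    _≤_             : Rel Carrier ℓ₂
    isDecTotalOrder : IsDecTotalOrder _≈_ _≤_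
    _⁻¹             : Carrier → Carrier
    ⁻¹-cong         : ∀ {x y} → x ≈ y → x ⁻¹ ≈ y ⁻¹
    ⁻¹-inverseʳ     : ∀ x → ¬ x ≈ 0# → x * x ⁻¹ ≈ 1#
    0≉1             : ¬ 0# ≈ 1#
    +-monoˡ-≤       : ∀ z {x y} → x ≤ y → x + z ≤ y + z
    *-nonNegative   : ∀ {x y} → 0# ≤ x → 0# ≤ y → 0# ≤ x * y

  open IsDecTotalOrder isDecTotalOrder public using (_≤?_)
  open ToStrict _≈_ _≤_ public using (_<_)
  open Sum +-commutativeMonoid public using (sum)

-- Finite simple undirected graphs on the nodes Fin n with edges Fin m.  Every
-- edge is stored with an arbitrary orientation, which Joins forgets.

Joins : ∀ {n m} (source target : Fin m → Fin n) → Fin m → Fin n → Fin n → Set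
Joins source target e u v =
  (source e ≡ u × target e ≡ v) ⊎ (source e ≡ v × target e ≡ u)

record Graph (n m : ℕ) : Set where
  field
    source target : Fin m → Fin n
    loopless      : ∀ e → source e ≢ target e
    simple        : ∀ {e e′ u v} → Joins source target e u v →
                    Joins source target e′ u v → e ≡ e′

  _joins_and_ : Fin m → Fin n → Fin n → Set
  e joins u and v = Joins source target e u v

IsStar : ∀ {n m} → Graph n m → Set
IsStar {n} {m} G =
  Σ (Fin n) λ v₀ →
    (∀ v → v ≢ v₀ → ∃[ e ] e joins v₀ and v) ×
    (∀ e → ∃[ v ] v ≢ v₀ × e joins v₀ and v)
  where open Graph G

data Walk {n m} (G : Graph n m) : Fin n → Fin n → Set where
  stay : ∀ {u} → Walk G u u
  step : ∀ {u v x} (e : Fin m) → Graph._joins_and_ G e u v →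
         Walk G v x → Walk G u x

nodes : ∀ {n m} {G : Graph n m} {u v} → Walk G u v → List (Fin n)
nodes {u = u} stay         = u ∷ []
nodes {u = u} (step _ _ W) = u ∷ nodes W

IsPath : ∀ {n m} {G : Graph n m} {u v} → Walk G u v → Set
IsPath W = Unique (nodes W)

module _ {c ℓ₁ ℓ₂} (F : OrderedField c ℓ₁ ℓ₂) where

  open OrderedField F

  record Instance (n m : ℕ) : Set (c ⊔ ℓ₁ ⊔ ℓ₂) where
    field
      graph    : Graph n m
      length   : Fin m → Carrier
      bound    : Fin m → Carrier
      cost     : Fin m → Carrier
      weight   : Fin n → Carrier
      radius   : Carrier
      budget   : Carrier
      p        : ℕ
      length>0 : ∀ e → 0# < length e
      bound≥0  : ∀ e → 0# ≤ bound e
      bound<   : ∀ e → bound e < length e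
      cost≥0   : ∀ e → 0# ≤ cost e
      weight≥0 : ∀ i → 0# ≤ weight i
      radius>0 : 0# < radius
      budget≥0 : 0# ≤ budget
      p≤n      : p ℕ.≤ n

  record Solution (n m : ℕ) : Set c where
    constructor solution
    field
      facilities : Subset n
      reduction  : Fin m → Carrier

module _ {c ℓ₁ ℓ₂} {F : OrderedField c ℓ₁ ℓ₂} {n m} (I : Instance F n m) where

  open OrderedField F
  open Instance I
  open Solution

  UniformWeights : Set (c ⊔ ℓ₁ ⊔ ℓ₂)
  UniformWeights = ∃[ w ] 0# ≤ w × (∀ i → weight i ≈ w)

  walkLength : (Fin m → Carrier) → ∀ {i j} → Walk graph i j → Carrier
  walkLength δ stay         = 0#
  walkLength δ (step e _ W) = (length e - δ e) + walkLength δ W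

  -- d = d(i , j , δ).  No d qualifies when i and j are not connected, that is,
  -- when the distance is infinite.
  IsDistance : (Fin m → Carrier) → Fin n → Fin n → Carrier → Set (ℓ₁ ⊔ ℓ₂)
  IsDistance δ i j d =
    (Σ (Walk graph i j) λ P → IsPath P × walkLength δ P ≈ d) ×
    (∀ (P : Walk graph i j) → IsPath P → d ≤ walkLength δ P)

  Covered : Solution F n m → Fin n → Set (c ⊔ ℓ₁ ⊔ ℓ₂)
  Covered s i =
    ∃[ j ] j ∈ facilities s ×
           (∃[ d ] IsDistance (reduction s) i j d × d ≤ radius)

  record Feasible (s : Solution F n m) : Set (ℓ₁ ⊔ ℓ₂) where
    field
      facilities-size : ∣ facilities s ∣ ≡ p
      reduction≥0     : ∀ e → 0# ≤ reduction s e
      reduction≤bound : ∀ e → reduction s e ≤ bound e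
      within-budget   : sum (λ e → cost e * reduction s e) ≤ budget

  totalWeight : Subset n → Carrier
  totalWeight C = sum λ i → if lookup C i then weight i else 0#

  HasObjective : Solution F n m → Carrier → Set (c ⊔ ℓ₁ ⊔ ℓ₂)
  HasObjective s z =
    Σ (Subset n) λ C → (∀ i → i ∈ C ⇔ Covered s i) × z ≈ totalWeight C

  IsOptimal : Solution F n m → Set (c ⊔ ℓ₁ ⊔ ℓ₂)
  IsOptimal s =
    Feasible s ×
    (∃[ z ] HasObjective s z ×
      (∀ s′ z′ → Feasible s′ → HasObjective s′ z′ → z′ ≤ z))

-- Algebraic computation trees.  A program reaches the input numbers only
-- through arithmetic operations and comparisons on registers, each of which
-- costs one unit; it does not depend on the field.  Input registers are
-- read-only, and work registers hold 0# initially.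

data Register (n m : ℕ) : Set where
  lengthOf boundOf costOf : Fin m → Register n m
  weightOf                : Fin n → Register n m
  radius budget           : Register n m
  work                    : ℕ → Register n m

data Operation : Set where
  add sub mul div : Operation

data Program (n m : ℕ) : Set where
  compute   : (target : ℕ) → Operation → (x y : Register n m) →
              Program n m → Program n m
  ifLeq     : (x y : Register n m) (yes-branch no-branch : Program n m) →
              Program n m
  return    : (facilities : Subset n) (reduction : Fin m → Register n m) →
              Program n m

-- The combinatorial part of an instance is known when the program starts.

Algorithm : Set
Algorithm = ∀ {n m} → Graph n m → Program n m

module _ {c ℓ₁ ℓ₂} {F : OrderedField c ℓ₁ ℓ₂} {n m} (I : Instance F n m) where

  open OrderedField F
  private module I = Instance I

  Store : Set c
  Store = ℕ → Carrier

  write : ℕ → Carrier → Store → Store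
  write r x σ k = if r ℕ.≡ᵇ k then x else σ k

  read : Store → Register n m → Carrier
  read σ (lengthOf e) = I.length e
  read σ (boundOf e)  = I.bound e
  read σ (costOf e)   = I.cost e
  read σ (weightOf i) = I.weight i
  read σ radius       = I.radius
  read σ budget       = I.budget
  read σ (work k)     = σ k

  apply : Operation → Carrier → Carrier → Carrier
  apply add x y = x + y
  apply sub x y = x - y
  apply mul x y = x * y
  apply div x y = x * y ⁻¹

  -- The returned solution, and the number of operations and comparisons made.
  execute : Program n m → Store → Solution F n m × ℕ
  execute (compute r o x y P) σ =
    map₂ suc (execute P (write r (apply o (read σ x) (read σ y)) σ))
  execute (ifLeq x y P Q) σ =
    map₂ suc (if does (read σ x ≤? read σ y) then execute P σ else execute Q σ)
  execute (return X δ) σ = solution X (λ e → read σ (δ e)) , 0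

  run : Algorithm → Solution F n m × ℕ
  run A = execute (A I.graph) (λ _ → 0#)

  output : Algorithm → Solution F n m
  output A = proj₁ (run A)

  time : Algorithm → ℕ
  time A = proj₂ (run A)

infix 4 _∈O_

_∈O_ : (ℕ → ℕ) → (ℕ → ℕ) → Set
f ∈O g = ∃[ K ] ∃[ n₀ ] (∀ n → n₀ ℕ.≤ n → f n ℕ.≤ K ℕ.* g n)

{-# OPTIONS --safe #-}
module Submission where

-- With uniform weights the centre is always an optimal location.  A facility at
-- a satellite either covers only itself, and then the centre, which covers
-- itself, is as good; or it covers the centre, and then every node it covers is
-- covered by the centre under the same reductions.  From the centre, a satellite
-- on edge e is covered exactly when e is reduced by its shortfall
-- max(0, length − radius), at price cost · shortfall.  So an optimal set of
-- satellites consists of the cheapest edges whose shortfall is within bounds,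
-- taken in order of price until the budget is exhausted; merge sort provides
-- that order with O(n log n) comparisons.

open import Defs
import Algebra.Properties.AbelianGroup as AbelianGroupProperties
open import Data.Bool.Base using (true; false; if_then_else_; T)
open import Data.Bool.Properties using (T?; T-≡)
open import Data.Fin.Base using (Fin; zero; suc; combine; toℕ)
open import Data.Fin.Properties using (any?; all?; _≟_; combine-injective; toℕ-injective; injective⇒≤)
open import Data.Fin.Subset using (Subset; ⁅_⁆; ⊥; inside; outside; _∈_; ∣_∣)
open import Data.Fin.Subset.Properties using (x∈⁅x⁆; x∈⁅y⁆⇒x≡y; ∣⁅x⁆∣≡1)
open import Data.List.Base as List using (List; []; _∷_; _++_; map; filter; take; drop; length; allFin)
open import Data.List.Membership.Propositional using () renaming (_∈_ to _∈ˡ_)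
open import Data.List.Membership.Propositional.Properties using (∈-∃++; ∈-allFin; ∈-filter⁺; ∈-filter⁻; ∈-map⁺; ∈-map⁻)
import Data.List.Membership.DecPropositional as DecMembership
open import Data.List.Properties using (length-take; length-drop; length-map; length-tabulate; length-++; length-filter; filter-accept; filter-reject; take++drop≡id; ++-identityʳ)
open import Data.List.Relation.Binary.Permutation.Propositional using (_↭_; prep; ↭-refl; ↭-sym; ↭-trans; ↭-reflexive; ↭⇒↭ₛ)
import Data.List.Relation.Binary.Permutation.Propositional as Permutation
open import Data.List.Relation.Binary.Permutation.Propositional.Properties using (∈-resp-↭; All-resp-↭; ↭-length; shift; ++⁺)
import Data.List.Relation.Binary.Permutation.Setoid.Properties as SetoidPermutation
open import Data.List.Relation.Binary.Sublist.Propositional using ([]; _∷_; _∷ʳ_; minimum) renaming (_⊆_ to _⊑_)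
open import Data.List.Relation.Binary.Sublist.Propositional.Properties using (∷ˡ⁻; filter-⊆; All-resp-⊆; Any-resp-⊆)
open import Data.List.Relation.Binary.Subset.Propositional using (_⊆_)
open import Data.List.Relation.Unary.All as All using (All; []; _∷_)
import Data.List.Relation.Unary.All.Properties as All
open import Data.List.Relation.Unary.AllPairs using (AllPairs; []; _∷_)
open import Data.List.Relation.Unary.Any using (here; there)
open import Data.List.Relation.Unary.Unique.Propositional using (Unique)
open import Data.List.Relation.Unary.Unique.Propositional.Properties using (allFin⁺; filter⁺; map⁺)
open import Data.Nat.Base using (ℕ; zero; _≡ᵇ_; suc; _+_; _*_; _^_; _∸_; _≤_; z≤n; s≤s; ⌈_/2⌉; ⌊_/2⌋)
open import Data.Nat.Induction using (<-rec)
open import Data.Nat.Logarithm using (⌈log₂_⌉; ⌈log₂⌉-mono-≤; ⌈log₂⌈n/2⌉⌉≡⌈log₂n⌉∸1)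
open import Data.Nat.Properties as ℕ using (≤-trans; ≤-reflexive)
open import Data.Nat.Solver using (module +-*-Solver)
open import Data.Product.Base using (Σ; ∃-syntax; _×_; _,_; proj₁; proj₂)
open import Data.Sum.Base using (_⊎_; inj₁; inj₂; [_,_]′; swap)
open import Data.Vec.Base using ([]; _∷_; lookup; tabulate)
open import Data.Vec.Properties using (lookup∘tabulate; []=⇒lookup; lookup⇒[]=)
open import Function.Base using (_∘_; id; const)
open import Function.Bundles using (_⇔_; mk⇔; module Equivalence)
open import Level using (Level; _⊔_)
open import Relation.Binary.Bundles using (Poset)
open import Relation.Binary.PropositionalEquality.Properties using (setoid)
open import Relation.Binary.PropositionalEquality.Core using (_≡_; _≢_; refl; sym; trans; cong; cong₂; subst)
import Relation.Binary.Reasoning.PartialOrder as PosetReasoning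
open import Relation.Binary.Structures using (IsDecTotalOrder)
open import Relation.Nullary.Decidable using (Dec; yes; no; does; ¬?; _×-dec_; _⊎-dec_; _→-dec_)
open import Relation.Nullary.Negation.Core using (¬_; contradiction)
open import Relation.Unary using (Pred; Decidable)

-- Lists without repetition, finite subsets and binary logarithms

module ∈ˡ {m : ℕ} = DecMembership (_≟_ {m})
open ∈ˡ using (_∈?_)

private variable
  a b c ℓ ℓ₁ ℓ₂ : Level
  A : Set a
  m n : ℕ

-- Comparisons of lengths and of nonnegative sums below rest on this splitting. As the head of `xs`
-- does not recur in its tail, removing one occurrence of it from `ys` leaves the tail still
-- included.
unique-⊆⇒↭ : {xs ys : List A} → Unique xs → xs ⊆ ys → ∃[ zs ] ys ↭ xs ++ zs
unique-⊆⇒↭ {xs = []} {ys} [] xs⊆ys = ys , ↭-refl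
unique-⊆⇒↭ {xs = x ∷ xs} (x∉xs ∷ xs!) xs⊆ys
  with h , t , refl ← ∈-∃++ (xs⊆ys (here refl)) = proj₁ ih ,
    ↭-trans (shift x h t) (prep x (proj₂ ih))
  where
  rest : xs ⊆ h ++ t
  rest z∈xs with ∈-resp-↭ (shift x h t) (xs⊆ys (there z∈xs))
  ... | here refl = contradiction refl (All.lookup x∉xs z∈xs)
  ... | there z∈  = z∈
  ih = unique-⊆⇒↭ xs! rest

unique-⊆⇒length-≤ : {xs ys : List A} → Unique xs → xs ⊆ ys → length xs ≤ length ys
unique-⊆⇒length-≤ {xs = xs} {ys} xs! xs⊆ys with zs , ys↭ ← unique-⊆⇒↭ xs! xs⊆ys = begin
  length xs             ≤⟨ ℕ.m≤m+n _ _ ⟩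
  length xs + length zs ≡⟨ length-++ xs ⟨
  length (xs ++ zs)     ≡⟨ ↭-length ys↭ ⟨
  length ys             ∎
  where open ℕ.≤-Reasoning

unique-resp-↭ : {xs ys : List A} → xs ↭ ys → Unique xs → Unique ys
unique-resp-↭ xs↭ys = SetoidPermutation.Unique-resp-↭ (setoid _) (↭⇒↭ₛ xs↭ys)

unique-resp-⊑ : {xs ys : List A} → xs ⊑ ys → Unique ys → Unique xs
unique-resp-⊑ []             _            = []
unique-resp-⊑ (_ ∷ʳ xs⊑)     (_ ∷ ys!)    = unique-resp-⊑ xs⊑ ys!
unique-resp-⊑ (refl ∷ xs⊑)   (y∉ys ∷ ys!) = All-resp-⊆ xs⊑ y∉ys ∷ unique-resp-⊑ xs⊑ ys!

∣p∣≡0⇒p≡⊥ : (p : Subset n) → ∣ p ∣ ≡ 0 → p ≡ ⊥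
∣p∣≡0⇒p≡⊥ []            _  = refl
∣p∣≡0⇒p≡⊥ (outside ∷ p) eq = cong (outside ∷_) (∣p∣≡0⇒p≡⊥ p eq)

∣p∣≡1⇒p≡⁅x⁆ : (p : Subset n) → ∣ p ∣ ≡ 1 → ∃[ x ] p ≡ ⁅ x ⁆
∣p∣≡1⇒p≡⁅x⁆ (inside  ∷ p) eq = zero , cong (inside ∷_) (∣p∣≡0⇒p≡⊥ p (ℕ.suc-injective eq))
∣p∣≡1⇒p≡⁅x⁆ (outside ∷ p) eq with x , refl ← ∣p∣≡1⇒p≡⁅x⁆ p eq = suc x , refl

∈⇔T-lookup : {p : Subset n} {i : Fin n} → i ∈ p ⇔ T (lookup p i)
∈⇔T-lookup {p = p} {i} = mk⇔
  (λ i∈p → Equivalence.from T-≡ ([]=⇒lookup i∈p))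
  (λ t → lookup⇒[]= i p (Equivalence.to T-≡ t))

T-does : {P : Set a} (d : Dec P) → T (does d) ⇔ P
T-does (yes p) = mk⇔ (const p) _
T-does (no ¬p) = mk⇔ (λ ()) ¬p

-- Halving lowers the logarithm by one and the bound doubles back. This makes `⌈log₂ n ⌉` levels of
-- merging enough for `n` elements.
n≤2^⌈log₂n⌉ : ∀ n → n ≤ 2 ^ ⌈log₂ n ⌉
n≤2^⌈log₂n⌉ = <-rec _ go
  where
  open ℕ.≤-Reasoning
  go : ∀ n → (∀ {k} → suc k ≤ n → k ≤ 2 ^ ⌈log₂ k ⌉) → n ≤ 2 ^ ⌈log₂ n ⌉
  go zero          _  = z≤n
  go (suc zero)    _  = s≤s z≤n
  go n@(suc (suc k)) ih = begin
    n                            ≡⟨ ℕ.⌊n/2⌋+⌈n/2⌉≡n n ⟨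
    ⌊ n /2⌋ + ⌈ n /2⌉             ≤⟨ ℕ.+-monoˡ-≤ _ (ℕ.⌊n/2⌋≤⌈n/2⌉ n) ⟩
    ⌈ n /2⌉ + ⌈ n /2⌉             ≤⟨ ℕ.+-mono-≤ half half ⟩
    2 ^ l + 2 ^ l                ≡⟨ cong (2 ^ l +_) (ℕ.+-identityʳ (2 ^ l)) ⟨
    2 ^ suc l                    ≡⟨ cong (2 ^_) (ℕ.m+[n∸m]≡n (⌈log₂⌉-mono-≤ {2} {n} (s≤s (s≤s z≤n)))) ⟩
    2 ^ ⌈log₂ n ⌉                ∎
    where
    -- The subtraction does not truncate: `n` is at least 2 here, so its logarithm is at least 1.
    l = ⌈log₂ n ⌉ ∸ 1
    half : ⌈ n /2⌉ ≤ 2 ^ l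
    half = subst (λ e → ⌈ n /2⌉ ≤ 2 ^ e) (⌈log₂⌈n/2⌉⌉≡⌈log₂n⌉∸1 n) (ih (ℕ.⌈n/2⌉<n k))

-- Ordered fields

module OrderedFieldProperties (F : OrderedField c ℓ₁ ℓ₂) where

  open OrderedField F renaming (_+_ to _⊕_; _*_ to _⊛_; _≤_ to _≼_)
    hiding (refl; sym; trans; zero; setoid)
  module ≈ = OrderedField F using (refl; sym; trans; reflexive)
  module ≼ = IsDecTotalOrder isDecTotalOrder
  open AbelianGroupProperties +-abelianGroup using (//-rightDividesˡ; //-rightDividesʳ)

  ≼-poset : Poset _ _ _
  ≼-poset = record { isPartialOrder = ≼.isPartialOrder }

  module ≼-Reasoning = PosetReasoning ≼-poset

  ≰⇒≽ : ∀ {x y} → ¬ x ≼ y → y ≼ x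
  ≰⇒≽ {x} {y} x≰y = [ (λ x≼y → contradiction x≼y x≰y) , id ]′ (≼.total x y)

  +-mono-≼ : ∀ {w x y z} → w ≼ x → y ≼ z → w ⊕ y ≼ x ⊕ z
  +-mono-≼ {w} {x} {y} {z} w≼x y≼z = begin
    w ⊕ y ≤⟨ +-monoˡ-≤ y w≼x ⟩
    x ⊕ y ≈⟨ +-comm x y ⟩
    y ⊕ x ≤⟨ +-monoˡ-≤ x y≼z ⟩
    z ⊕ x ≈⟨ +-comm z x ⟩
    x ⊕ z ∎
    where open ≼-Reasoning

  x≼x+y : ∀ {x y} → 0# ≼ y → x ≼ x ⊕ y
  x≼x+y {x} {y} 0≼y = begin
    x      ≈⟨ +-identityʳ x ⟨
    x ⊕ 0# ≤⟨ +-mono-≼ ≼.refl 0≼y ⟩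
    x ⊕ y  ∎
    where open ≼-Reasoning

  +-nonNegative : ∀ {x y} → 0# ≼ x → 0# ≼ y → 0# ≼ x ⊕ y
  +-nonNegative 0≼x 0≼y = ≼.trans 0≼x (x≼x+y 0≼y)

  -- Serves twice for a shortfall `length − radius`: it shows that this reduction brings the edge
  -- within the radius and that no smaller one does.
  x-y≼z⇒x-z≼y : ∀ {x y z} → x - y ≼ z → x - z ≼ y
  x-y≼z⇒x-z≼y {x} {y} {z} x-y≼z = begin
    x - z             ≈⟨ +-congʳ (//-rightDividesˡ y x) ⟨
    x - y ⊕ y - z     ≤⟨ +-monoˡ-≤ (- z) (+-monoˡ-≤ y x-y≼z) ⟩
    z ⊕ y - z         ≈⟨ +-congʳ (+-comm z y) ⟩
    y ⊕ z - z         ≈⟨ //-rightDividesʳ z y ⟩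
    y                 ∎
    where open ≼-Reasoning

  x-0≈x : ∀ x → x - 0# ≈ x
  x-0≈x x = ≈.trans (≈.sym (+-identityʳ (x - 0#))) (//-rightDividesˡ 0# x)

  x≼y⇒0≼y-x : ∀ {x y} → x ≼ y → 0# ≼ y - x
  x≼y⇒0≼y-x {x} {y} x≼y = begin
    0#    ≈⟨ -‿inverseʳ x ⟨
    x - x ≤⟨ +-monoˡ-≤ (- x) x≼y ⟩
    y - x ∎
    where open ≼-Reasoning

  *-monoʳ-≼ : ∀ {x y z} → 0# ≼ x → y ≼ z → x ⊛ y ≼ x ⊛ z
  *-monoʳ-≼ {x} {y} {z} 0≼x y≼z = begin
    x ⊛ y                     ≈⟨ +-identityˡ (x ⊛ y) ⟨
    0# ⊕ x ⊛ y                ≤⟨ +-monoˡ-≤ (x ⊛ y) (*-nonNegative 0≼x (x≼y⇒0≼y-x y≼z)) ⟩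
    x ⊛ (z - y) ⊕ x ⊛ y       ≈⟨ distribˡ x (z - y) y ⟨
    x ⊛ (z - y ⊕ y)           ≈⟨ *-congˡ (//-rightDividesˡ y z) ⟩
    x ⊛ z                     ∎
    where open ≼-Reasoning

  ∑ : (A → Carrier) → List A → Carrier
  ∑ f []       = 0#
  ∑ f (x ∷ xs) = f x ⊕ ∑ f xs

  module _ {f : A → Carrier} where

    ∑-nonNegative : (∀ x → 0# ≼ f x) → ∀ xs → 0# ≼ ∑ f xs
    ∑-nonNegative f≽0 []       = ≼.refl
    ∑-nonNegative f≽0 (x ∷ xs) = +-nonNegative (f≽0 x) (∑-nonNegative f≽0 xs)

    ∑-mono : ∀ {g : A → Carrier} {xs} → All (λ x → f x ≼ g x) xs → ∑ f xs ≼ ∑ g xs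
    ∑-mono []           = ≼.refl
    ∑-mono (fx≼gx ∷ hs) = +-mono-≼ fx≼gx (∑-mono hs)

    ∑-↭ : ∀ {xs ys} → xs ↭ ys → ∑ f xs ≈ ∑ f ys
    ∑-↭ Permutation.refl          = ≈.refl
    ∑-↭ (prep x p)                = +-congˡ (∑-↭ p)
    ∑-↭ (Permutation.swap x y p)  = ≈.trans (≈.sym (+-assoc (f x) (f y) _))
      (≈.trans (+-cong (+-comm (f x) (f y)) (∑-↭ p)) (+-assoc (f y) (f x) _))
    ∑-↭ (Permutation.trans p q)   = ≈.trans (∑-↭ p) (∑-↭ q)

    ∑-++ˡ : (∀ x → 0# ≼ f x) → ∀ xs {ys} → ∑ f xs ≼ ∑ f (xs ++ ys)
    ∑-++ˡ f≽0 []       {ys} = ∑-nonNegative f≽0 ys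
    ∑-++ˡ f≽0 (x ∷ xs)      = +-mono-≼ ≼.refl (∑-++ˡ f≽0 xs)

    ∑-unique-⊆ : (∀ x → 0# ≼ f x) → ∀ {xs ys} → Unique xs → xs ⊆ ys → ∑ f xs ≼ ∑ f ys
    ∑-unique-⊆ f≽0 {xs} {ys} xs! xs⊆ys with zs , ys↭ ← unique-⊆⇒↭ xs! xs⊆ys = begin
      ∑ f xs         ≤⟨ ∑-++ˡ f≽0 xs ⟩
      ∑ f (xs ++ zs) ≈⟨ ∑-↭ ys↭ ⟨
      ∑ f ys         ∎
      where open ≼-Reasoning

    ∑-filter : ∀ {P : Pred A ℓ} (P? : Decidable P) xs →
               ∑ (λ x → if does (P? x) then f x else 0#) xs ≈ ∑ f (filter P? xs)
    ∑-filter P? []       = ≈.refl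
    ∑-filter P? (x ∷ xs) with does (P? x)
    ... | true  = +-congˡ (∑-filter P? xs)
    ... | false = ≈.trans (+-identityˡ _) (∑-filter P? xs)

  ∑-const-mono : ∀ {w} → 0# ≼ w → (xs ys : List A) → length xs ≤ length ys →
                 ∑ (const w) xs ≼ ∑ (const w) ys
  ∑-const-mono 0≼w []       ys       _         = ∑-nonNegative (const 0≼w) ys
  ∑-const-mono 0≼w (_ ∷ xs) (_ ∷ ys) (s≤s leq) = +-mono-≼ ≼.refl (∑-const-mono 0≼w xs ys leq)

  ∑-cong : ∀ {f g : A → Carrier} → (∀ x → f x ≈ g x) → ∀ xs → ∑ f xs ≈ ∑ g xs
  ∑-cong f≈g []       = ≈.refl
  ∑-cong f≈g (x ∷ xs) = +-cong (f≈g x) (∑-cong f≈g xs)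

  -- The index map `g` is arbitrary because the induction replaces it by `g ∘ suc`.
  sum≡∑-tabulate : ∀ {n} (f : A → Carrier) (g : Fin n → A) →
                   sum (f ∘ g) ≡ ∑ f (List.tabulate g)
  sum≡∑-tabulate {n = zero}  f g = refl
  sum≡∑-tabulate {n = suc n} f g = cong (f (g zero) ⊕_) (sum≡∑-tabulate f (g ∘ suc))

  sum≡∑ : ∀ {n} (f : Fin n → Carrier) → sum f ≡ ∑ f (allFin n)
  sum≡∑ f = sum≡∑-tabulate f id

-- Coverage in star networks

-- An algorithm is given the graph alone, so the centre has to be found. The search is combinatorial
-- and costs no arithmetic operation or comparison of numbers.
isStar? : (G : Graph n m) → Dec (IsStar G)
isStar? {n} {m} G = any? λ v₀ →
  all? (λ v → ¬? (v ≟ v₀) →-dec any? λ e → joins? e v₀ v) ×-dec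
  all? (λ e → any? λ v → ¬? (v ≟ v₀) ×-dec joins? e v₀ v)
  where
  open Graph G
  joins? : ∀ e u v → Dec (e joins u and v)
  joins? e u v = (source e ≟ u ×-dec target e ≟ v) ⊎-dec (source e ≟ v ×-dec target e ≟ u)

module Star (G : Graph n m) (star : IsStar G) where

  open Graph G

  centre : Fin n
  centre = proj₁ star

  satellite : Fin m → Fin n
  satellite e = proj₁ (proj₂ (proj₂ star) e)

  satellite≢centre : ∀ e → satellite e ≢ centre
  satellite≢centre e = proj₁ (proj₂ (proj₂ (proj₂ star) e))

  spoke : ∀ e → e joins centre and satellite e
  spoke e = proj₂ (proj₂ (proj₂ (proj₂ star) e))

  -- Both edges would join the same two nodes of a simple graph. Spokes can therefore be counted by
  -- their satellites.
  satellite-injective : ∀ {e f} → satellite e ≡ satellite f → e ≡ f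
  satellite-injective {e} {f} eq = simple (spoke e) (subst (f joins centre and_) (sym eq) (spoke f))

  ends : ∀ {e u v} → e joins u and v →
         (u ≡ centre × v ≡ satellite e) ⊎ (u ≡ satellite e × v ≡ centre)
  ends {e} (inj₁ (refl , refl)) with spoke e
  ... | inj₁ (p , q) = inj₁ (p , q)
  ... | inj₂ (p , q) = inj₂ (p , q)
  ends {e} (inj₂ (refl , refl)) with spoke e
  ... | inj₁ (p , q) = inj₂ (q , p)
  ... | inj₂ (p , q) = inj₁ (q , p)

  centre-or-satellite : ∀ v → v ≡ centre ⊎ (∃[ e ] v ≡ satellite e)
  centre-or-satellite v with v ≟ centre
  ... | yes v≡c = inj₁ v≡c
  ... | no  v≢c with e , J ← proj₁ (proj₂ star) v v≢c with ends J
  ...   | inj₁ (_ , v≡s) = inj₂ (e , v≡s)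
  ...   | inj₂ (c≡s , _) = contradiction (sym c≡s) (satellite≢centre e)

  m≤n : m ≤ n
  m≤n = injective⇒≤ {f = satellite} satellite-injective

module Coverage {F : OrderedField c ℓ₁ ℓ₂} (I : Instance F n m)
                (star : IsStar (Instance.graph I)) where

  open OrderedField F renaming (_+_ to _⊕_; _*_ to _⊛_; _≤_ to _≼_)
    hiding (refl; sym; trans; zero; setoid)
  open OrderedFieldProperties F
  module I = Instance I
  open Star I.graph star

  Bridged : (Fin m → Carrier) → Fin m → Set ℓ₂
  Bridged δ e = I.length e - δ e ≼ I.radius

  -- `v` is the one node covered for free: the centre, or a satellite cut off from it. All others
  -- need their own bridged spoke, so at most one node more than the number of bridged spokes is
  -- covered.
  Via : (Fin m → Carrier) → Fin n → Fin n → Set ℓ₂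
  Via δ v i = i ≡ v ⊎ (∃[ e ] i ≡ satellite e × Bridged δ e)

  module _ {δ : Fin m → Carrier} (δ≼bound : ∀ e → δ e ≼ I.bound e) where

    reduced≽0 : ∀ e → 0# ≼ I.length e - δ e
    reduced≽0 e = x≼y⇒0≼y-x (≼.trans (δ≼bound e) (proj₁ (I.bound< e)))

    walkLength≽0 : ∀ {i j} (W : Walk I.graph i j) → 0# ≼ walkLength I δ W
    walkLength≽0 stay         = ≼.refl
    walkLength≽0 (step e _ W) = +-nonNegative (reduced≽0 e) (walkLength≽0 W)

    -- The only edge at a satellite is its spoke, so a walk leaving the satellite pays for that
    -- spoke, and the rest of the walk has nonnegative length.
    first-edge : ∀ {i j} (W : Walk I.graph i j) → i ≢ j → i ≢ centre →
                 ∃[ e ] i ≡ satellite e × I.length e - δ e ≼ walkLength I δ W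
    first-edge stay         i≢j _   = contradiction refl i≢j
    first-edge (step e J W) _   i≢c with ends J
    ... | inj₁ (i≡c , _) = contradiction i≡c i≢c
    ... | inj₂ (i≡s , _) = e , i≡s , x≼x+y (walkLength≽0 W)

    -- The mirror image of `first-edge`: a walk that arrives at a satellite from elsewhere has to
    -- enter through its spoke.
    last-edge : ∀ {i j e} (W : Walk I.graph i j) → j ≡ satellite e → i ≢ j →
                I.length e - δ e ≼ walkLength I δ W
    last-edge stay _ i≢j = contradiction refl i≢j
    last-edge {j = j} {e} (step {v = v} f J W) j≡s i≢j with v ≟ j
    ... | no  v≢j  = ≼.trans (last-edge W j≡s v≢j)
                       (≼.trans (x≼x+y (reduced≽0 f)) (≼.reflexive (+-comm _ _)))
    ... | yes refl with ends J
    ...   | inj₂ (_ , v≡c) = contradiction (trans (sym j≡s) v≡c) (satellite≢centre e)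
    ...   | inj₁ (_ , v≡s) with refl ← satellite-injective (trans (sym j≡s) v≡s) =
      x≼x+y (walkLength≽0 W)

    covered-via-centre : ∀ i → Covered I (solution ⁅ centre ⁆ δ) i → Via δ centre i
    covered-via-centre i (j , j∈ , d , ((W , _ , W≈d) , _) , d≼R)
      with refl ← x∈⁅y⁆⇒x≡y centre j∈ | i ≟ centre
    ... | yes i≡c = inj₁ i≡c
    ... | no  i≢c with e , i≡s , le ← first-edge W i≢c i≢c =
      inj₂ (e , i≡s , ≼.trans le (≼.trans (≼.reflexive W≈d) d≼R))

    covered-via-satellite : ∀ e → Bridged δ e → ∀ i →
                            Covered I (solution ⁅ satellite e ⁆ δ) i → Via δ centre i
    covered-via-satellite e br i (j , j∈ , d , ((W , _ , W≈d) , _) , d≼R)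
      with refl ← x∈⁅y⁆⇒x≡y (satellite e) j∈ | i ≟ centre | i ≟ satellite e
    ... | yes i≡c | _       = inj₁ i≡c
    ... | no  i≢c | yes i≡s = inj₂ (e , i≡s , br)
    ... | no  i≢c | no  i≢s with f , i≡sf , le ← first-edge W i≢s i≢c =
      inj₂ (f , i≡sf , ≼.trans le (≼.trans (≼.reflexive W≈d) d≼R))

    covered-isolated : ∀ e → ¬ Bridged δ e → ∀ i →
                       Covered I (solution ⁅ satellite e ⁆ δ) i → Via δ (satellite e) i
    covered-isolated e ¬br i (j , j∈ , d , ((W , _ , W≈d) , _) , d≼R)
      with refl ← x∈⁅y⁆⇒x≡y (satellite e) j∈ | i ≟ satellite e
    ... | yes i≡s = inj₁ i≡s
    ... | no  i≢s = contradiction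
      (≼.trans (last-edge W refl i≢s) (≼.trans (≼.reflexive W≈d) d≼R)) ¬br

    -- A facility that reaches the centre covers nothing that the centre would not; a satellite
    -- whose spoke exceeds the radius covers only itself.
    covered-bound : ∀ j → ∃[ v ] ∀ i → Covered I (solution ⁅ j ⁆ δ) i → Via δ v i
    covered-bound j with centre-or-satellite j
    ... | inj₁ refl = centre , covered-via-centre
    ... | inj₂ (e , refl) with I.length e - δ e ≤? I.radius
    ...   | yes br = centre , covered-via-satellite e br
    ...   | no ¬br = satellite e , covered-isolated e ¬br

    -- The distance is realised by the empty path or by a single spoke; the latter is shortest
    -- because every walk out of the satellite begins with it.
    centre-covers : ∀ i → Via δ centre i → Covered I (solution ⁅ centre ⁆ δ) i
    centre-covers i (inj₁ refl) = centre , x∈⁅x⁆ centre , 0# ,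
      ((stay , [] ∷ [] , ≈.refl) , λ W _ → walkLength≽0 W) , proj₁ I.radius>0
    centre-covers i (inj₂ (e , refl , br)) = centre , x∈⁅x⁆ centre , _ ,
      ((step e (swap (spoke e)) stay , (satellite≢centre e ∷ []) ∷ [] ∷ [] , +-identityʳ _) ,
       λ W _ → shortest W) , br
      where
      shortest : (W : Walk I.graph (satellite e) centre) → I.length e - δ e ≼ walkLength I δ W
      shortest W with f , s≡s , le ← first-edge W (satellite≢centre e) (satellite≢centre e)
        with refl ← satellite-injective s≡s = le
  -- This is max(0, length - radius), given by its extremal property so that either branch of a
  -- comparison can supply it.
  record IsShortfall (e : Fin m) (x : Carrier) : Set (c ⊔ ℓ₂) where
    field
      nonNegative : 0# ≼ x
      bridges     : I.length e - x ≼ I.radius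
      least       : ∀ {y} → 0# ≼ y → I.length e - y ≼ I.radius → x ≼ y

  -- Optimality of a largest affordable set of spokes

  module _ (p≡1 : I.p ≡ 1) (uniform : UniformWeights I)
           {x : Fin m → Carrier} (shortfall : ∀ e → IsShortfall e (x e)) where

    private module x e = IsShortfall (shortfall e)

    price : Fin m → Carrier
    price e = I.cost e ⊛ x e

    price≽0 : ∀ e → 0# ≼ price e
    price≽0 e = *-nonNegative (I.cost≥0 e) (x.nonNegative e)

    record Affordable (es : List (Fin m)) : Set (c ⊔ ℓ₂) where
      field
        unique        : Unique es
        within-bounds : ∀ {e} → e ∈ˡ es → x e ≼ I.bound e
        within-budget : ∑ price es ≼ I.budget

    -- With equal weights the objective depends only on how many nodes are covered, so objectives
    -- can be compared by counting.
    totalWeight≈ : ∀ C → totalWeight I C ≈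
                   ∑ (const (proj₁ uniform)) (filter (T? ∘ lookup C) (allFin n))
    totalWeight≈ C = begin
      totalWeight I C
        ≡⟨ sum≡∑ (λ i → if lookup C i then I.weight i else 0#) ⟩
      ∑ (λ i → if lookup C i then I.weight i else 0#) (allFin n)
        ≈⟨ ∑-filter (T? ∘ lookup C) (allFin n) ⟩
      ∑ I.weight (filter (T? ∘ lookup C) (allFin n))
        ≈⟨ ∑-cong (proj₂ (proj₂ uniform)) (filter (T? ∘ lookup C) (allFin n)) ⟩
      ∑ (const (proj₁ uniform)) (filter (T? ∘ lookup C) (allFin n)) ∎
      where open import Relation.Binary.Reasoning.Setoid (OrderedField.setoid F)

    -- The reduction is constrained by an equation instead of being defined, so that values read
    -- from the registers of a program can take its place.
    module _ {chosen : List (Fin m)} (affordable : Affordable chosen)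
             (largest : ∀ es → Affordable es → length es ≤ length chosen)
             {δ : Fin m → Carrier}
             (δ≡ : ∀ e → δ e ≡ (if does (e ∈? chosen) then x e else 0#)) where

      module chosen = Affordable affordable

      δ-nonNegative : ∀ e → 0# ≼ δ e
      δ-nonNegative e rewrite δ≡ e with e ∈? chosen
      ... | yes _ = x.nonNegative e
      ... | no  _ = ≼.refl

      δ≼bound : ∀ e → δ e ≼ I.bound e
      δ≼bound e rewrite δ≡ e with e ∈? chosen
      ... | yes e∈ = chosen.within-bounds e∈
      ... | no  _  = I.bound≥0 e

      chosen-bridged : ∀ {e} → e ∈ˡ chosen → Bridged δ e
      chosen-bridged {e} e∈ rewrite δ≡ e with e ∈? chosen
      ... | yes _  = x.bridges e
      ... | no  e∉ = contradiction e∈ e∉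

      δ-cost : ∀ e → I.cost e ⊛ δ e ≈ (if does (e ∈? chosen) then price e else 0#)
      δ-cost e rewrite δ≡ e with e ∈? chosen
      ... | yes _ = ≈.refl
      ... | no  _ = zeroʳ (I.cost e)

      feasible : Feasible I (solution ⁅ centre ⁆ δ)
      feasible = record
        { facilities-size = trans (∣⁅x⁆∣≡1 centre) (sym p≡1)
        ; reduction≥0     = δ-nonNegative
        ; reduction≤bound = δ≼bound
        ; within-budget   = begin
            sum (λ e → I.cost e ⊛ δ e)
              ≡⟨ sum≡∑ (λ e → I.cost e ⊛ δ e) ⟩
            ∑ (λ e → I.cost e ⊛ δ e) (allFin m)
              ≈⟨ ∑-cong δ-cost (allFin m) ⟩
            ∑ (λ e → if does (e ∈? chosen) then price e else 0#) (allFin m)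
              ≈⟨ ∑-filter (_∈? chosen) (allFin m) ⟩
            ∑ price (filter (_∈? chosen) (allFin m))
              ≤⟨ ∑-unique-⊆ price≽0 (filter⁺ (_∈? chosen) (allFin⁺ m))
                   (proj₂ ∘ ∈-filter⁻ (_∈? chosen) {xs = allFin m}) ⟩
            ∑ price chosen
              ≤⟨ chosen.within-budget ⟩
            I.budget ∎
        }
        where open ≼-Reasoning

      via-centre? : Decidable (Via δ centre)
      via-centre? i = (i ≟ centre) ⊎-dec
        any? (λ e → (i ≟ satellite e) ×-dec (I.length e - δ e ≤? I.radius))

      coveredSet : Subset n
      coveredSet = tabulate (does ∘ via-centre?)

      T-coveredSet : ∀ {i} → T (lookup coveredSet i) ⇔ Via δ centre i
      T-coveredSet {i} rewrite lookup∘tabulate (does ∘ via-centre?) i =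
        T-does (via-centre? i)

      ∈-coveredSet : ∀ i → i ∈ coveredSet ⇔ Covered I (solution ⁅ centre ⁆ δ) i
      ∈-coveredSet i = mk⇔
        (centre-covers δ≼bound i ∘ Equivalence.to T-coveredSet ∘ Equivalence.to ∈⇔T-lookup)
        (Equivalence.from ∈⇔T-lookup ∘ Equivalence.from T-coveredSet ∘ covered-via-centre δ≼bound i)

      coveredNodes : Subset n → List (Fin n)
      coveredNodes C = filter (T? ∘ lookup C) (allFin n)

      -- The extra node is the centre, which covers itself and differs from all satellites.
      many-covered : suc (length chosen) ≤ length (coveredNodes coveredSet)
      many-covered = begin
        suc (length chosen)                     ≡⟨ cong suc (length-map satellite chosen) ⟨
        length (centre ∷ map satellite chosen)  ≤⟨ unique-⊆⇒length-≤ nodes! nodes⊆ ⟩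
        length (coveredNodes coveredSet)        ∎
        where
        open ℕ.≤-Reasoning
        nodes! : Unique (centre ∷ map satellite chosen)
        nodes! = All.tabulate (λ v∈ → λ { refl → let e , _ , c≡s = ∈-map⁻ satellite v∈ in
                   satellite≢centre e (sym c≡s) })
                 ∷ map⁺ satellite-injective chosen.unique
        via : ∀ {v} → v ∈ˡ centre ∷ map satellite chosen → Via δ centre v
        via (here refl) = inj₁ refl
        via (there v∈) with e , e∈ , v≡s ← ∈-map⁻ satellite v∈ =
          inj₂ (e , v≡s , chosen-bridged e∈)
        nodes⊆ : centre ∷ map satellite chosen ⊆ coveredNodes coveredSet
        nodes⊆ {v} v∈ = ∈-filter⁺ (T? ∘ lookup coveredSet) (∈-allFin v)
          (Equivalence.from T-coveredSet (via v∈))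

      module _ {δ′ : Fin m → Carrier} {j : Fin n}
               (feasible′ : Feasible I (solution ⁅ j ⁆ δ′)) where

        open Feasible feasible′

        bridged? : Decidable (Bridged δ′)
        bridged? e = I.length e - δ′ e ≤? I.radius

        bridgedEdges : List (Fin m)
        bridgedEdges = filter bridged? (allFin m)

        x≼δ′ : ∀ {e} → e ∈ˡ bridgedEdges → x e ≼ δ′ e
        x≼δ′ {e} e∈ = x.least e (reduction≥0 e) (proj₂ (∈-filter⁻ bridged? {xs = allFin m} e∈))

        -- A feasible competitor reduces each spoke it bridges by at least the shortfall. Lowering
        -- those reductions to the shortfall and dropping all others respects the bounds and cannot
        -- raise the cost.
        bridgedEdges-affordable : Affordable bridgedEdges
        bridgedEdges-affordable = record
          { unique        = filter⁺ bridged? (allFin⁺ m)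
          ; within-bounds = λ {e} e∈ → ≼.trans (x≼δ′ e∈) (reduction≤bound e)
          ; within-budget = begin
              ∑ price bridgedEdges
                ≤⟨ ∑-mono (All.tabulate λ {e} e∈ → *-monoʳ-≼ (I.cost≥0 e) (x≼δ′ e∈)) ⟩
              ∑ (λ e → I.cost e ⊛ δ′ e) bridgedEdges
                ≤⟨ ∑-unique-⊆ (λ e → *-nonNegative (I.cost≥0 e) (reduction≥0 e))
                     (filter⁺ bridged? (allFin⁺ m)) (λ {e} _ → ∈-allFin e) ⟩
              ∑ (λ e → I.cost e ⊛ δ′ e) (allFin m)
                ≡⟨ sum≡∑ (λ e → I.cost e ⊛ δ′ e) ⟨
              sum (λ e → I.cost e ⊛ δ′ e)
                ≤⟨ within-budget ⟩
              I.budget ∎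
          }
          where open ≼-Reasoning

        -- The extra node is the free one provided by `covered-bound`.
        few-covered : ∀ C → (∀ i → i ∈ C ⇔ Covered I (solution ⁅ j ⁆ δ′) i) →
                      length (coveredNodes C) ≤ suc (length bridgedEdges)
        few-covered C C⇔ with v , bound ← covered-bound reduction≤bound j = begin
          length (coveredNodes C)
            ≤⟨ unique-⊆⇒length-≤ (filter⁺ (T? ∘ lookup C) (allFin⁺ n)) ⊆nodes ⟩
          length (v ∷ map satellite bridgedEdges)
            ≡⟨ cong suc (length-map satellite bridgedEdges) ⟩
          suc (length bridgedEdges) ∎
          where
          open ℕ.≤-Reasoning
          ⊆nodes : coveredNodes C ⊆ v ∷ map satellite bridgedEdges
          ⊆nodes {i} i∈ with bound i (Equivalence.to (C⇔ i) (Equivalence.from ∈⇔T-lookup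
            (proj₂ (∈-filter⁻ (T? ∘ lookup C) {xs = allFin n} i∈))))
          ... | inj₁ refl              = here refl
          ... | inj₂ (e , refl , br)   = there (∈-map⁺ satellite (∈-filter⁺ bridged? (∈-allFin e) br))

        -- Both coverage counts are compared with one plus a number of spokes, and `largest`
        -- compares these numbers.
        no-better : ∀ z′ → HasObjective I (solution ⁅ j ⁆ δ′) z′ → z′ ≼ totalWeight I coveredSet
        no-better z′ (C , C⇔ , z′≈) = begin
          z′
            ≈⟨ z′≈ ⟩
          totalWeight I C
            ≈⟨ totalWeight≈ C ⟩
          ∑ (const (proj₁ uniform)) (coveredNodes C)
            ≤⟨ ∑-const-mono (proj₁ (proj₂ uniform)) (coveredNodes C) (coveredNodes coveredSet) counts ⟩
          ∑ (const (proj₁ uniform)) (coveredNodes coveredSet)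
            ≈⟨ totalWeight≈ coveredSet ⟨
          totalWeight I coveredSet ∎
          where
          open ≼-Reasoning
          counts : length (coveredNodes C) ≤ length (coveredNodes coveredSet)
          counts = ≤-trans (few-covered C C⇔)
            (≤-trans (s≤s (largest bridgedEdges bridgedEdges-affordable)) many-covered)

      centre-optimal : IsOptimal I (solution ⁅ centre ⁆ δ)
      centre-optimal = feasible , totalWeight I coveredSet ,
        (coveredSet , ∈-coveredSet , ≈.refl) , λ where
          (solution X δ′) z′ f′ obj′ →
            let _ , X≡ = ∣p∣≡1⇒p≡⁅x⁆ X (trans (Feasible.facilities-size f′) p≡1) in
            no-better (subst (λ X → Feasible I (solution X δ′)) X≡ f′) z′
              (subst (λ X → HasObjective I (solution X δ′) z′) X≡ obj′)

-- The program

-- Names for the work registers in use. `zeroCell` is never written and keeps its initial zero;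
-- `total` accumulates the spending.
data Cell (m : ℕ) : Set where
  zeroCell total   : Cell m
  shortfall price  : Fin m → Cell m

-- Cells form a table with two columns, whose row `zero` holds the two global cells; numbering the
-- table gives distinct addresses.
row : Cell m → Fin (suc m)
row zeroCell      = zero
row total         = zero
row (shortfall e) = suc e
row (price e)     = suc e

column : Cell m → Fin 2
column zeroCell      = zero
column total         = suc zero
column (shortfall _) = zero
column (price _)     = suc zero

at : Fin (suc m) → Fin 2 → Cell m
at zero    zero       = zeroCell
at zero    (suc zero) = total
at (suc e) zero       = shortfall e
at (suc e) (suc zero) = price e

at-row-column : (c : Cell m) → at (row c) (column c) ≡ c
at-row-column zeroCell      = refl
at-row-column total         = refl
at-row-column (shortfall e) = refl
at-row-column (price e)     = refl

-- Abstract, so that unification recovers a cell from its address.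
abstract

  address : Cell m → ℕ
  address c = toℕ (combine (row c) (column c))

  address-injective : {c d : Cell m} → address c ≡ address d → c ≡ d
  address-injective {c = c} {d} eq
    with row≡ , column≡ ← combine-injective (row c) (column c) (row d) (column d) (toℕ-injective eq) =
    trans (sym (at-row-column c)) (trans (cong₂ at row≡ column≡) (at-row-column d))

cell : Cell m → Register n m
cell = work ∘ address

-- Programs are built with continuations, so that a list computed by comparisons
-- is at hand when the rest of the program is laid out.

prepare : List (Fin m) → Program n m → Program n m
prepare []       P = P
prepare (e ∷ es) P = ifLeq (lengthOf e) radius
  -- A zero shortfall is written as the sum of two zeros.
  (compute (address (shortfall e)) add (cell zeroCell) (cell zeroCell) continue)
  (compute (address (shortfall e)) sub (lengthOf e) radius continue)
  where
  continue = compute (address (price e)) mul (costOf e) (cell (shortfall e)) (prepare es P)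

select : List (Fin m) → (List (Fin m) → Program n m) → Program n m
select []       k = k []
select (e ∷ es) k = ifLeq (cell (shortfall e)) (boundOf e)
  (select es (k ∘ (e ∷_)))
  (select es k)

merge : List (Fin m) → List (Fin m) → (List (Fin m) → Program n m) → Program n m
merge []       fs       k = k fs
merge (e ∷ es) []       k = k (e ∷ es)
merge (e ∷ es) (f ∷ fs) k = ifLeq (cell (price e)) (cell (price f))
  (merge es (f ∷ fs) (k ∘ (e ∷_)))
  (merge (e ∷ es) fs (k ∘ (f ∷_)))

-- The number is the depth of the recursion: depth `d` sorts lists of length at most `2 ^ d`.
-- Splitting at a power of two keeps both parts within the next depth.
sort : ℕ → List (Fin m) → (List (Fin m) → Program n m) → Program n m
sort zero    es k = k es
sort (suc d) es k =
  sort d (take (2 ^ d) es) λ fs → sort d (drop (2 ^ d) es) λ gs → merge fs gs k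

-- On a list sorted by price, the first overrun of the budget ends the selection. The overrun stays
-- in `total`, which the returned solution does not read.
fill : List (Fin m) → (List (Fin m) → Program n m) → Program n m
fill []       k = k []
fill {m} (e ∷ es) k = compute (address {m} total) add (cell total) (cell (price e))
  (ifLeq (cell total) budget (fill es (k ∘ (e ∷_))) (k []))

locate : Fin n → List (Fin m) → Program n m
locate v es = return ⁅ v ⁆ λ e → cell (if does (e ∈? es) then shortfall e else zeroCell)

coverFrom : Fin n → Program n m
coverFrom {n} {m} v =
  prepare (allFin m) (select (allFin m) λ es → sort ⌈log₂ n ⌉ es λ fs → fill fs (locate v))

coverFromCentre : (G : Graph n m) → Dec (IsStar G) → Program n m
coverFromCentre G (yes (v₀ , _)) = coverFrom v₀
-- A default for graphs that are not stars, about which nothing is claimed.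
coverFromCentre G (no _)         = return ⊥ (const budget)

-- Per edge: three units to prepare, one to select, one for each level of merging and two to fill.
-- The number of edges is bounded by `n`.
running-time : ℕ → ℕ
running-time n = 3 * n + (n + (⌈log₂ n ⌉ * n + (2 * n + 0)))

-- From `n` = 2 on the logarithm is at least 1, so the six linear terms are absorbed and join the
-- one term `n * ⌈log₂ n ⌉`.
running-time∈O : running-time ∈O (λ n → n * ⌈log₂ n ⌉)
running-time∈O = 7 , 2 , λ n 2≤n → begin
  running-time n
    ≡⟨ regroup n ⌈log₂ n ⌉ ⟩
  -- The factor 1 is the value of `⌈log₂ 2 ⌉`, to which monotonicity applies.
  n * 1 * 6 + n * ⌈log₂ n ⌉
    ≤⟨ ℕ.+-monoˡ-≤ _ (ℕ.*-monoˡ-≤ 6 (ℕ.*-monoʳ-≤ n (⌈log₂⌉-mono-≤ 2≤n))) ⟩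
  n * ⌈log₂ n ⌉ * 6 + n * ⌈log₂ n ⌉
    ≡⟨ collect (n * ⌈log₂ n ⌉) ⟩
  7 * (n * ⌈log₂ n ⌉) ∎
  where
  open ℕ.≤-Reasoning
  open +-*-Solver
  regroup : ∀ n l → 3 * n + (n + (l * n + (2 * n + 0))) ≡ n * 1 * 6 + n * l
  regroup = solve 2 (λ n l → con 3 :* n :+ (n :+ (l :* n :+ (con 2 :* n :+ con 0))) :=
                             n :* con 1 :* con 6 :+ n :* l) refl
  collect : ∀ x → x * 6 + x ≡ 7 * x
  collect = solve 1 (λ x → x :* con 6 :+ x := con 7 :* x) refl

-- Execution of the program

module Execution {F : OrderedField c ℓ₁ ℓ₂} (I : Instance F n m)
                 (star : IsStar (Instance.graph I)) where

  open OrderedField F renaming (_+_ to _⊕_; _*_ to _⊛_; _≤_ to _≼_)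
    hiding (refl; sym; trans; zero; setoid)
  open OrderedFieldProperties F
  open Star (Instance.graph I) star
  open Coverage I star hiding (price)

  _[_] : Store I → Cell m → Carrier
  σ [ c ] = σ (address c)

  write-same : ∀ r {x} (σ : Store I) → write I r x σ r ≡ x
  write-same r σ with r ≡ᵇ r | ℕ.≡⇒≡ᵇ r r refl
  ... | true | _ = refl

  write-other : ∀ {c d : Cell m} {x} (σ : Store I) → c ≢ d → write I (address c) x σ [ d ] ≡ σ [ d ]
  write-other {c} {d} σ c≢d with address c ≡ᵇ address d
                               | ℕ.≡ᵇ⇒≡ (address c) (address d)
  ... | false | _  = refl
  ... | true  | eq = contradiction (address-injective (eq _)) c≢d

  record Prepared (σ : Store I) (e : Fin m) : Set (c ⊔ ℓ₂) where
    field
      isShortfall : IsShortfall e (σ [ shortfall e ])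
      isPrice     : σ [ price e ] ≡ I.cost e ⊛ σ [ shortfall e ]

  module _ (σ : Store I) where

    Cheaper : Fin m → Fin m → Set ℓ₂
    Cheaper e f = σ [ price e ] ≼ σ [ price f ]

    Sorted : List (Fin m) → Set ℓ₂
    Sorted = AllPairs Cheaper

    Fits : Fin m → Set ℓ₂
    Fits e = σ [ shortfall e ] ≼ I.bound e

    fits? : Decidable Fits
    fits? e = σ [ shortfall e ] ≤? I.bound e

  -- The invariant of `fill`: prices and shortfalls remain those by which the list was sorted.
  AgreeOffTotal : Store I → Store I → Set c
  AgreeOffTotal σ τ = ∀ {d} → total ≢ d → τ [ d ] ≡ σ [ d ]

  -- Specifications with time bounds, and the computation of shortfalls and prices

  module _ (Φ : Solution F n m → Set ℓ) where

    -- A total correctness assertion from a given store. The lemmas below carry it from a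
    -- continuation to the program that ends in it.
    record Ensures (σ : Store I) (P : Program n m) (t : ℕ) : Set ℓ where
      constructor ensures
      field
        output-satisfies : Φ (proj₁ (execute I P σ))
        time-bounded     : proj₂ (execute I P σ) ≤ t

    ensures-weaken : ∀ {σ P t u} → t ≤ u → Ensures σ P t → Ensures σ P u
    ensures-weaken t≤u (ensures φ time≤) = ensures φ (≤-trans time≤ t≤u)

    ensures-compute : ∀ {σ r o y z P t} →
      Ensures (write I r (apply I o (read I σ y) (read I σ z)) σ) P t →
      Ensures σ (compute r o y z P) (suc t)
    ensures-compute (ensures φ time≤) = ensures φ (s≤s time≤)

    ensures-ifLeq : ∀ {σ y z P Q t} →
      (read I σ y ≼ read I σ z → Ensures σ P t) →
      (¬ read I σ y ≼ read I σ z → Ensures σ Q t) →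
      Ensures σ (ifLeq y z P Q) (suc t)
    ensures-ifLeq {σ} {y} {z} {P} {Q} {t} yes-case no-case = let φ , time≤ = run-branch in ensures φ time≤
      where
      run-branch : Φ (proj₁ (execute I (ifLeq y z P Q) σ)) × proj₂ (execute I (ifLeq y z P Q) σ) ≤ suc t
      run-branch with read I σ y ≤? read I σ z
      ... | yes y≼z = let ensures φ time≤ = yes-case y≼z in φ , s≤s time≤
      ... | no  y⋠z = let ensures φ time≤ = no-case y⋠z in φ , s≤s time≤

    module _ (e : Fin m) {y : Carrier} (y-shortfall : IsShortfall e y) (σ : Store I) where

      private
        σ₁ = write I (address {m} (shortfall e)) y σ
        σ₂ = write I (address {m} (price e)) (I.cost e ⊛ σ₁ [ shortfall e ]) σ₁

      σ₂-keeps : ∀ {d} → shortfall e ≢ d → price e ≢ d → σ₂ [ d ] ≡ σ [ d ]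
      σ₂-keeps s≢d p≢d = trans (write-other σ₁ p≢d) (write-other σ s≢d)

      σ₂-shortfall : σ₂ [ shortfall e ] ≡ y
      σ₂-shortfall = trans (write-other σ₁ (λ ())) (write-same (address (shortfall e)) σ)

      σ₂-prepared : ∀ {f} → f ≡ e ⊎ Prepared σ f → Prepared σ₂ f
      σ₂-prepared {f} h with f ≟ e | h
      ... | yes refl | _ = record
        { isShortfall = subst (IsShortfall e) (sym σ₂-shortfall) y-shortfall
        ; isPrice     = trans (write-same (address (price e)) σ₁)
                          (cong (I.cost e ⊛_) (sym (write-other σ₁ λ ())))
        }
      ... | no f≢e | inj₁ f≡e = contradiction f≡e f≢e
      ... | no f≢e | inj₂ pre = record
        { isShortfall = subst (IsShortfall f) (sym keeps-shortfall) (Prepared.isShortfall pre)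
        ; isPrice     = trans (σ₂-keeps (λ ()) λ { refl → f≢e refl })
                          (trans (Prepared.isPrice pre) (cong (I.cost f ⊛_) (sym keeps-shortfall)))
        }
        where
        keeps-shortfall : σ₂ [ shortfall f ] ≡ σ [ shortfall f ]
        keeps-shortfall = σ₂-keeps (λ { refl → f≢e refl }) (λ ())

    -- The store handed on must also preserve edges prepared earlier; this is what lets the
    -- induction keep the values of the head while the tail is processed.
    prepare-correct : ∀ es {σ P t} → σ [ zeroCell ] ≡ 0# → σ [ total ] ≡ 0# →
      (∀ τ → τ [ zeroCell ] ≡ 0# → τ [ total ] ≡ 0# →
        (∀ {f} → f ∈ˡ es ⊎ Prepared σ f → Prepared τ f) → Ensures τ P t) →
      Ensures σ (prepare es P) (length es * 3 + t)
    prepare-correct [] {σ} z t h = h σ z t λ where (inj₂ pre) → pre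
    prepare-correct (e ∷ es) {σ} {P} {t} z≡0 t≡0 h = ensures-ifLeq
      -- The spoke lies within the radius already, so its shortfall is zero.
      (λ ℓ≼R → ensures-compute (ensures-compute (continue (record
        { nonNegative = ≼.reflexive (≈.sym 0+0≈0)
        ; bridges     = begin
            I.length e - (σ [ zeroCell ] ⊕ σ [ zeroCell ]) ≈⟨ +-congˡ (-‿cong 0+0≈0) ⟩
            I.length e - 0#                                ≈⟨ x-0≈x _ ⟩
            I.length e                                     ≤⟨ ℓ≼R ⟩
            I.radius                                       ∎
        ; least       = λ 0≼y _ → ≼.trans (≼.reflexive 0+0≈0) 0≼y
        }))))
      -- The shortfall is `length − radius`, positive because the spoke is too long.
      (λ ℓ⋠R → ensures-compute (ensures-compute (continue (record
        { nonNegative = x≼y⇒0≼y-x (≰⇒≽ ℓ⋠R)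
        ; bridges     = x-y≼z⇒x-z≼y ≼.refl
        ; least       = λ _ → x-y≼z⇒x-z≼y
        }))))
      where
      open ≼-Reasoning
      0+0≈0 : σ [ zeroCell ] ⊕ σ [ zeroCell ] ≈ 0#
      0+0≈0 = ≈.trans (≈.reflexive (cong₂ _⊕_ z≡0 z≡0)) (+-identityˡ 0#)
      continue : ∀ {y} → IsShortfall e y →
        let σ₁ = write I (address {m} (shortfall e)) y σ in
        Ensures (write I (address {m} (price e)) (I.cost e ⊛ σ₁ [ shortfall e ]) σ₁)
                (prepare es P) (length es * 3 + t)
      continue y-shortfall = prepare-correct es
        (trans (σ₂-keeps e y-shortfall σ (λ ()) (λ ())) z≡0)
        (trans (σ₂-keeps e y-shortfall σ (λ ()) (λ ())) t≡0)
        λ τ z t pre → h τ z t λ where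
          (inj₁ (here f≡e)) → pre (inj₂ (σ₂-prepared e y-shortfall σ (inj₁ f≡e)))
          (inj₁ (there f∈)) → pre (inj₁ f∈)
          (inj₂ old)        → pre (inj₂ (σ₂-prepared e y-shortfall σ (inj₂ old)))

    -- Selection and merge sort

    module _ {σ : Store I} where

      select-correct : ∀ es {k t} → Ensures σ (k (filter (fits? σ) es)) t →
                       Ensures σ (select es k) (length es + t)
      select-correct []       h = h
      select-correct (e ∷ es) {k} {t} h = ensures-ifLeq
        (λ fits → select-correct es
          (subst (λ fs → Ensures σ (k fs) t) (filter-accept (fits? σ) fits) h))
        (λ ¬fits → select-correct es
          (subst (λ fs → Ensures σ (k fs) t) (filter-reject (fits? σ) ¬fits) h))

      -- Each comparison emits one element, hence the time bound. The emitted head is no dearer than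
      -- anything left in either list, and the permutation carries this over to the merged rest.
      merge-correct : ∀ {es fs k t} → Sorted σ es → Sorted σ fs →
        (∀ gs → gs ↭ es ++ fs → Sorted σ gs → Ensures σ (k gs) t) →
        Ensures σ (merge es fs k) (length es + length fs + t)
      merge-correct {[]} {fs} {k} {t} _ fs↗ h =
        ensures-weaken (ℕ.m≤n+m t (length fs)) (h fs ↭-refl fs↗)
      merge-correct {e ∷ es} {[]} {k} {t} es↗ _ h =
        ensures-weaken (ℕ.m≤n+m t (suc (length es) + 0))
          (h (e ∷ es) (↭-reflexive (sym (++-identityʳ (e ∷ es)))) es↗)
      merge-correct {e ∷ es} {f ∷ fs} {k} {t} (e≼es ∷ es↗) (f≼fs ∷ fs↗) h = ensures-ifLeq
        (λ e≼f → merge-correct es↗ (f≼fs ∷ fs↗) λ gs gs↭ gs↗ →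
          h (e ∷ gs) (prep e gs↭) (All-resp-↭ (↭-sym gs↭)
            (All.++⁺ e≼es (e≼f ∷ All.map (≼.trans e≼f) f≼fs)) ∷ gs↗))
        (λ e⋠f → let f≼e = ≰⇒≽ e⋠f in
          ensures-weaken (≤-reflexive (cong (_+ t) (sym (ℕ.+-suc (length es) (length fs)))))
            (merge-correct (e≼es ∷ es↗) fs↗ λ gs gs↭ gs↗ →
              h (f ∷ gs) (↭-trans (prep f gs↭) (↭-sym (shift f (e ∷ es) fs)))
                (All-resp-↭ (↭-sym gs↭)
                  (f≼e ∷ All.++⁺ (All.map (≼.trans f≼e) e≼es) f≼fs) ∷ gs↗)))

      -- Each of the `d` levels spends at most `length es` comparisons on merging; at depth zero
      -- there is at most one element.
      sort-correct : ∀ d es {k t} → length es ≤ 2 ^ d →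
        (∀ fs → fs ↭ es → Sorted σ fs → Ensures σ (k fs) t) →
        Ensures σ (sort d es k) (d * length es + t)
      sort-correct zero []           _        h = h [] ↭-refl []
      sort-correct zero (e ∷ [])     _        h = h (e ∷ []) ↭-refl ([] ∷ [])
      sort-correct zero (_ ∷ _ ∷ _)  (s≤s ()) h
      sort-correct (suc d) es {k} {t} es≤ h =
        ensures-weaken (≤-reflexive total-time)
          (sort-correct d front front≤ λ fs fs↭ fs↗ →
            sort-correct d back back≤ λ gs gs↭ gs↗ →
              ensures-weaken (≤-reflexive (cong₂ (λ a b → a + b + t) (↭-length fs↭) (↭-length gs↭)))
                (merge-correct fs↗ gs↗ λ hs hs↭ hs↗ →
                  h hs (↭-trans hs↭ (↭-trans (++⁺ fs↭ gs↭) (↭-reflexive (take++drop≡id (2 ^ d) es)))) hs↗))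
        where
        front = take (2 ^ d) es
        back  = drop (2 ^ d) es
        front≤ : length front ≤ 2 ^ d
        front≤ = ≤-trans (≤-reflexive (length-take (2 ^ d) es)) (ℕ.m⊓n≤m _ _)
        back≤ : length back ≤ 2 ^ d
        back≤ = begin
          length back               ≡⟨ length-drop (2 ^ d) es ⟩
          length es ∸ 2 ^ d         ≤⟨ ℕ.∸-monoˡ-≤ (2 ^ d) es≤ ⟩
          2 ^ suc d ∸ 2 ^ d         ≡⟨ ℕ.m+n∸m≡n (2 ^ d) _ ⟩
          2 ^ d + 0                 ≡⟨ ℕ.+-identityʳ _ ⟩
          2 ^ d                     ∎
          where open ℕ.≤-Reasoning
        total-time : d * length front + (d * length back + (length front + length back + t))
                   ≡ suc d * length es + t
        total-time = trans (regroup d (length front) (length back) t)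
          (cong (λ l → suc d * l + t)
            (trans (sym (length-++ front)) (cong length (take++drop≡id (2 ^ d) es))))
          where
          open +-*-Solver
          regroup : ∀ d a b t → d * a + (d * b + (a + b + t)) ≡ suc d * (a + b) + t
          regroup = solve 4 (λ d a b t → d :* a :+ (d :* b :+ (a :+ b :+ t)) :=
                                         (con 1 :+ d) :* (a :+ b) :+ t) refl

    -- Greedy spending of the budget

    module _ (σ₀ : Store I) (price≽0 : ∀ e → 0# ≼ σ₀ [ price e ]) where

      spending : List (Fin m) → Carrier
      spending = ∑ (λ e → σ₀ [ price e ])

      -- Exchanging its first edge for the cheapest one keeps an affordable
      -- sublist affordable, so taking the cheapest edges is a largest choice.
      fill-correct : ∀ es {σ k t} → Sorted σ₀ es → AgreeOffTotal σ₀ σ → σ [ total ] ≼ I.budget →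
        (∀ τ fs → AgreeOffTotal σ₀ τ → fs ⊑ es → σ [ total ] ⊕ spending fs ≼ I.budget →
          (∀ gs → gs ⊑ es → σ [ total ] ⊕ spending gs ≼ I.budget → length gs ≤ length fs) →
          Ensures τ (k fs) t) →
        Ensures σ (fill es k) (length es * 2 + t)
      fill-correct [] {σ} _ agree total≼ h =
        h σ [] agree [] (≼.trans (≼.reflexive (+-identityʳ _)) total≼) λ where [] [] _ → z≤n
      fill-correct (e ∷ es) {σ} {k} {t} (e≼es ∷ es↗) agree total≼ h = ensures-compute (ensures-ifLeq
        (λ fits → fill-correct es es↗ agree₁ fits λ τ fs agree′ fs⊑es fs-fits fs-largest →
          h τ (e ∷ fs) agree′ (refl ∷ fs⊑es) (≼.trans (≼.reflexive (≈.sym (shift-total fs))) fs-fits)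
            λ where
              [] _ _ → z≤n
              (g ∷ gs) gs⊑ gs-fits → s≤s (fs-largest gs (tail-⊑ gs⊑)
                (≼.trans (≼.reflexive (shift-total gs)) (≼.trans (exchange gs⊑) gs-fits))))
        -- If the cheapest edge left overruns the budget, so does any nonempty choice: exchange its
        -- first edge for `e` and drop the others.
        (λ ¬fits → ensures-weaken (ℕ.m≤n+m t (length es * 2)) (h σ₁ [] agree₁ (minimum (e ∷ es))
          (≼.trans (≼.reflexive (+-identityʳ _)) total≼)
          λ where
            [] _ _ → z≤n
            (g ∷ gs) gs⊑ gs-fits → contradiction
              (≼.trans (x≼x+y (∑-nonNegative price≽0 gs))
                (≼.trans (≼.reflexive (shift-total gs)) (≼.trans (exchange gs⊑) gs-fits))) ¬fits)))
        where
        open ≼-Reasoning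
        σ₁ = write I (address {m} total) (σ [ total ] ⊕ σ [ price e ]) σ
        agree₁ : AgreeOffTotal σ₀ σ₁
        agree₁ total≢d = trans (write-other σ total≢d) (agree total≢d)
        shift-total : ∀ fs → σ₁ [ total ] ⊕ spending fs ≈ σ [ total ] ⊕ spending (e ∷ fs)
        shift-total fs = ≈.trans
          (+-congʳ (≈.reflexive (trans (write-same (address {m} total) σ)
            (cong (σ [ total ] ⊕_) (agree (λ ()))))))
          (+-assoc _ _ _)
        tail-⊑ : ∀ {g gs} → g ∷ gs ⊑ e ∷ es → gs ⊑ es
        tail-⊑ (refl ∷ gs⊑) = gs⊑
        tail-⊑ (_ ∷ʳ gs⊑)   = ∷ˡ⁻ gs⊑
        exchange : ∀ {g gs} → g ∷ gs ⊑ e ∷ es →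
                   σ [ total ] ⊕ spending (e ∷ gs) ≼ σ [ total ] ⊕ spending (g ∷ gs)
        exchange (refl ∷ gs⊑) = ≼.refl
        exchange (_ ∷ʳ gs⊑)   = +-mono-≼ ≼.refl
          (+-monoˡ-≤ _ (All.lookup e≼es (Any-resp-⊆ gs⊑ (here refl))))

  -- Correctness and running time of the whole program

  coverFrom-correct : I.p ≡ 1 → UniformWeights I →
    Ensures (IsOptimal I) (const 0#) (coverFrom centre) (running-time n)
  coverFrom-correct p≡1 uniform = ensures-weaken (IsOptimal I) time≤
    (prepare-correct (IsOptimal I) (allFin m) refl refl λ σ zero≡0 total≡0 prepared →
      let pre : ∀ e → Prepared σ e
          pre e = prepared (inj₁ (∈-allFin e))
      in Prepared-correct σ zero≡0 total≡0 (Prepared.isShortfall ∘ pre) (Prepared.isPrice ∘ pre))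
    where
    k = ⌈log₂ n ⌉

    Prepared-correct : ∀ σ → σ [ zeroCell ] ≡ 0# → σ [ total ] ≡ 0# →
      (∀ e → IsShortfall e (σ [ shortfall e ])) →
      (∀ e → σ [ price e ] ≡ I.cost e ⊛ σ [ shortfall e ]) →
      Ensures (IsOptimal I) σ (select (allFin m) λ es → sort k es λ fs → fill fs (locate centre))
        (length (allFin m) + (k * m + (m * 2 + 0)))
    Prepared-correct σ zero≡0 total≡0 short price≡ =
      select-correct (IsOptimal I) (allFin m)
        (ensures-weaken (IsOptimal I) (ℕ.+-monoˡ-≤ _ (ℕ.*-monoʳ-≤ k eligible≤m))
          (sort-correct (IsOptimal I) k eligible
            -- The depth suffices, since there are at most `m` eligible spokes, `m` is at most `n`,
            -- and `n` is at most `2 ^ ⌈log₂ n ⌉`.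
            (≤-trans eligible≤m (≤-trans m≤n (n≤2^⌈log₂n⌉ n))) sorted-correct))
      where
      eligible = filter (fits? σ) (allFin m)

      eligible≤m : length eligible ≤ m
      eligible≤m = ≤-trans (length-filter (fits? σ) (allFin m)) (≤-reflexive (length-tabulate id))

      price≽0′ : ∀ e → 0# ≼ σ [ price e ]
      price≽0′ e = ≼.trans (price≽0 p≡1 uniform short e) (≼.reflexive (≈.reflexive (sym (price≡ e))))

      spending≈ : ∀ es → ∑ (λ e → I.cost e ⊛ σ [ shortfall e ]) es ≈
                         σ [ total ] ⊕ spending (IsOptimal I) σ price≽0′ es
      spending≈ es = ≈.trans (∑-cong (λ e → ≈.reflexive (sym (price≡ e))) es)
        (≈.trans (≈.sym (+-identityˡ _)) (+-congʳ (≈.reflexive (sym total≡0))))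

      sorted-correct : ∀ fs → fs ↭ eligible → Sorted σ fs →
        Ensures (IsOptimal I) σ (fill fs (locate centre)) (m * 2 + 0)
      sorted-correct fs fs↭ fs↗ = ensures-weaken (IsOptimal I)
        (ℕ.+-monoˡ-≤ 0 (ℕ.*-monoˡ-≤ 2 (≤-trans (≤-reflexive (↭-length fs↭)) eligible≤m)))
        (fill-correct (IsOptimal I) σ price≽0′ fs fs↗ (λ _ → refl)
          (≼.trans (≼.reflexive (≈.reflexive total≡0)) I.budget≥0)
          λ τ gs agree gs⊑fs gs-fits gs-largest →
            ensures (centre-optimal p≡1 uniform short
              (record
                { unique        = unique-resp-⊑ gs⊑fs fs!
                ; within-bounds = λ e∈ → proj₂ (∈-filter⁻ (fits? σ) {xs = allFin m}
                                    (∈-resp-↭ fs↭ (Any-resp-⊆ gs⊑fs e∈)))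
                ; within-budget = ≼.trans (≼.reflexive (spending≈ gs)) gs-fits
                })
              -- An arbitrary affordable list need not follow the sorted order. Filtering `fs` by
              -- membership in `es` rearranges it into a sublist of `fs`, no shorter and no dearer,
              -- to which the greedy bound applies.
              (λ es affordable → ≤-trans (unique-⊆⇒length-≤ (Affordable.unique affordable) (es⊆ affordable))
                (gs-largest (filter (_∈? es) fs) (filter-⊆ (_∈? es) fs) (begin
                  σ [ total ] ⊕ spending (IsOptimal I) σ price≽0′ (filter (_∈? es) fs)
                    ≈⟨ spending≈ (filter (_∈? es) fs) ⟨
                  ∑ (λ e → I.cost e ⊛ σ [ shortfall e ]) (filter (_∈? es) fs)
                    ≤⟨ ∑-unique-⊆ (price≽0 p≡1 uniform short) (filter⁺ (_∈? es) fs!)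
                         (proj₂ ∘ ∈-filter⁻ (_∈? es) {xs = fs}) ⟩
                  ∑ (λ e → I.cost e ⊛ σ [ shortfall e ]) es
                    ≤⟨ Affordable.within-budget affordable ⟩
                  I.budget ∎)))
              (λ e → reduction≡ τ agree (does (e ∈? gs)))) z≤n)
        where
        open ≼-Reasoning
        fs! : Unique fs
        fs! = unique-resp-↭ (↭-sym fs↭) (filter⁺ (fits? σ) (allFin⁺ m))
        es⊆ : ∀ {es} → Affordable p≡1 uniform short es → es ⊆ filter (_∈? es) fs
        es⊆ {es} affordable {e} e∈ = ∈-filter⁺ (_∈? es)
          (∈-resp-↭ (↭-sym fs↭) (∈-filter⁺ (fits? σ) (∈-allFin e) (Affordable.within-bounds affordable e∈))) e∈
        reduction≡ : ∀ τ → AgreeOffTotal σ τ → ∀ {e} b →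
          τ [ (if b then shortfall e else zeroCell) ] ≡ (if b then σ [ shortfall e ] else 0#)
        reduction≡ τ agree true  = agree (λ ())
        reduction≡ τ agree false = trans (agree (λ ())) zero≡0

    time≤ : length (allFin m) * 3 + (length (allFin m) + (k * m + (m * 2 + 0))) ≤ running-time n
    time≤ rewrite length-tabulate {n = m} id | ℕ.*-comm m 3 | ℕ.*-comm m 2 =
      ℕ.+-mono-≤ (ℕ.*-monoʳ-≤ 3 m≤n) (ℕ.+-mono-≤ m≤n
        (ℕ.+-mono-≤ (ℕ.*-monoʳ-≤ k m≤n) (ℕ.+-monoˡ-≤ 0 (ℕ.*-monoʳ-≤ 2 m≤n))))

-- The facility stands at the centre found by the decision, which on two nodes may differ from the
-- one in the hypothesis; the hypothesis rules out the negative answer.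
coverFromCentre-correct : {F : OrderedField c ℓ₁ ℓ₂} (I : Instance F n m) →
  Instance.p I ≡ 1 → UniformWeights I → IsStar (Instance.graph I) →
  (star? : Dec (IsStar (Instance.graph I))) →
  let result = execute I (coverFromCentre (Instance.graph I) star?) (const (OrderedField.0# F))
  in IsOptimal I (proj₁ result) × (proj₂ result ≤ running-time n)
coverFromCentre-correct I p≡1 uniform _    (yes star)
  with Execution.ensures optimal time≤ ← Execution.coverFrom-correct I star p≡1 uniform = optimal , time≤
coverFromCentre-correct I p≡1 uniform star (no ¬star) = contradiction star ¬star

theorem1 : ∀ {c ℓ₁ ℓ₂} →
    Σ Algorithm λ A →
    Σ (ℕ → ℕ) λ T →
    (T ∈O (λ n → n * ⌈log₂ n ⌉)) ×
    (∀ (F : OrderedField c ℓ₁ ℓ₂) {n m} (I : Instance F n m) →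
    Instance.p I ≡ 1 → IsStar (Instance.graph I) → UniformWeights I →
    IsOptimal I (output I A) × (time I A ≤ T n))
theorem1 =
  (λ G → coverFromCentre G (isStar? G)) , running-time , running-time∈O , λ F I p≡1 star uniform →
    coverFromCentre-correct I p≡1 uniform star (isStar? (Instance.graph I))
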